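{- Let $\mathbb P=\langle P,<\rangle$ be a strict partial order with $|P|=\kappa\ge\omega$ satisfying (u1) for all nonempty $L,G\in[P]^{<\kappa}$ with $L<G$ there is $x\in P$ with $L<x<G$; (u2) for every nonempty $K\in[P]^{<\kappa}$ there are $x,y,z\in P$ with $x<K$, $y>K$ and $z\parallel K$. Let $L,G,K\in[P]^{<\kappa}$ be nonempty with $L<G$. Then: (a) $|\{x\in P:L<x<G\}|=\kappa$; (b) $|\{x\in P:x<K\}|=|\{x\in P:x>K\}|=|\{x\in P:x\parallel K\}|=\kappa$; (c) if $\kappa$ is a regular cardinal, then $\mathbb P$ is not reversible. (d) Consequently, if $\kappa$ is a regular infinite cardinal and $\mathbb P$ is a $\kappa$-homogeneous-universal poset of size $\kappa$, then $\mathbb P$ is not reversible (in particular, the countable random poset is not reversible).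
   Context: $[P]^{<\kappa}$ is the set of subsets of $P$ of size $<\kappa$. For $p,q\in P$, $p\parallel q$ means $p\not\le q$ and $q\not\le p$. For $A,B\subseteq P$, $A<B$ means $a<b$ for all $a\in A,b\in B$; $x<K$ means $\{x\}<K$, etc., and $z\parallel K$ means $z\parallel k$ for all $k\in K$. A structure is reversible iff every bijective homomorphism from it onto itself (i.e. bijection $F:P\to P$ with $p<q\Rightarrow F(p)<F(q)$) is an automorphism. A poset $\mathbb P$ of size $\kappa$ is $\kappa$-homogeneous-universal iff every isomorphism between substructures of $\mathbb P$ of size $<\kappa$ extends to an automorphism of $\mathbb P$, and every poset of size $\le\kappa$ embeds into $\mathbb P$. -}

module Defs where

open import Data.Fin.Base using (Fin; fromℕ<)
open import Data.Fin.Properties using (ℕ→Fin-notInjective; fromℕ<-injective)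
open import Data.Irrelevant using ([_])
open import Data.Nat.Base as ℕ using (ℕ)
open import Data.Nat.Induction using (<-wellFounded)
open import Data.Nat.Properties as ℕ using (_<?_)
open import Data.Product using (_×_; ∃-syntax)
open import Data.Refinement.Base using (Refinement; value) renaming (_,_ to _,ʳ_)
open import Function.Base using (_on_)
open import Function.Bundles using (_↣_; _⤖_; module Bijection)
open import Function.Definitions using (Injective; Bijective)
open import Induction.WellFounded using (WellFounded)
open import Level using (0ℓ)
open import Relation.Binary.Core using (Rel)
open import Relation.Binary.Morphism.Structures
  using (IsOrderHomomorphism; IsOrderMonomorphism; IsOrderIsomorphism)
open import Relation.Binary.PropositionalEquality using (_≡_; refl)
open import Relation.Binary.Structures using (IsStrictPartialOrder; IsStrictTotalOrder)
import Relation.Binary.Construct.StrictToNonStrict as ToNonStrict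
open import Relation.Nullary.Decidable using (recompute)
open import Relation.Nullary.Negation using (¬_)
open import Relation.Unary using (Pred; _∈_; ｛_｝; Satisfiable)

------------------------------------------------------------------------
-- Cardinals

-- A subset as a type.  Membership proofs are irrelevant, so the elements
-- of ⟪ A ⟫ are the elements of A, each counted once.
⟪_⟫ : {X : Set} → Pred X 0ℓ → Set
⟪_⟫ {X} A = Refinement X A

-- A cardinal is an initial ordinal: a well-ordered set that is not
-- equinumerous with any of its proper initial segments.
record Cardinal : Set₁ where
  infix 4 _<_
  field
    Carrier            : Set
    _<_                : Rel Carrier 0ℓ
    isStrictTotalOrder : IsStrictTotalOrder _≡_ _<_
    wellFounded        : WellFounded _<_
    initial            : ∀ α → ¬ (Carrier ⤖ ⟪ (λ β → β < α) ⟫)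

  open ToNonStrict _≡_ _<_ public using (_≤_)

infix 4 ∣_∣≡_ ∣_∣≼_ ∣_∣≺_

∣_∣≡_ ∣_∣≼_ ∣_∣≺_ : Set → Cardinal → Set
∣ X ∣≡ κ = X ⤖ Cardinal.Carrier κ
∣ X ∣≼ κ = X ↣ Cardinal.Carrier κ
∣ X ∣≺ κ = ∣ X ∣≼ κ × ¬ (∣ X ∣≡ κ)

Infinite : Cardinal → Set
Infinite κ = ℕ ↣ Cardinal.Carrier κ

Cofinal : (κ : Cardinal) → Pred (Cardinal.Carrier κ) 0ℓ → Set
Cofinal κ C = ∀ α → ∃[ β ] β ∈ C × α ≤ β
  where open Cardinal κ

-- cf κ is the least cardinality of a cofinal subset of κ, so cf κ = κ says
-- that no cofinal subset has cardinality < κ.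
Regular : Cardinal → Set₁
Regular κ = ∀ C → Cofinal κ C → ¬ (∣ ⟪ C ⟫ ∣≺ κ)

ω : Cardinal
ω = record
  { Carrier            = ℕ
  ; _<_                = ℕ._<_
  ; isStrictTotalOrder = ℕ.<-isStrictTotalOrder
  ; wellFounded        = <-wellFounded
  ; initial            = notSegment
  }
  where
  toFin : ∀ {n} → ⟪ (λ m → m ℕ.< n) ⟫ → Fin n
  toFin {n} (m ,ʳ [ m<n ]) = fromℕ< {m} {n} (recompute (m <? n) m<n)

  toFin-injective : ∀ {n} → Injective _≡_ _≡_ (toFin {n})
  toFin-injective {n} {k ,ʳ [ k<n ]} {l ,ʳ [ l<n ]} eq
    with refl ← fromℕ<-injective k l
                  (recompute (k <? n) k<n) (recompute (l <? n) l<n) eq = refl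

  notSegment : ∀ n → ¬ (ℕ ⤖ ⟪ (λ m → m ℕ.< n) ⟫)
  notSegment n f = ℕ→Fin-notInjective (λ k → toFin (Bijection.to f k))
    (λ eq → Bijection.injective f (toFin-injective eq))

------------------------------------------------------------------------
-- Strict partial orders

record StrictPoset : Set₁ where
  infix 4 _<_
  field
    Carrier              : Set
    _<_                  : Rel Carrier 0ℓ
    isStrictPartialOrder : IsStrictPartialOrder _≡_ _<_

module Order (ℙ : StrictPoset) where
  open StrictPoset ℙ public using (_<_) renaming (Carrier to P)
  open ToNonStrict _≡_ _<_ public using (_≤_)

  infix 4 _∥_ _<ˢ_ _∥ˢ_

  _∥_ : Rel P 0ℓ
  p ∥ q = ¬ (p ≤ q) × ¬ (q ≤ p)

  _<ˢ_ : Pred P 0ℓ → Pred P 0ℓ → Set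
  A <ˢ B = ∀ a b → a ∈ A → b ∈ B → a < b

  _∥ˢ_ : P → Pred P 0ℓ → Set
  z ∥ˢ K = ∀ k → k ∈ K → z ∥ k

  -- The nonempty elements of [P]^{<κ}.
  NonemptySmall : Cardinal → Pred P 0ℓ → Set
  NonemptySmall κ A = Satisfiable A × ∣ ⟪ A ⟫ ∣≺ κ

  Between : Pred P 0ℓ → Pred P 0ℓ → Pred P 0ℓ
  Between L G x = L <ˢ ｛ x ｝ × ｛ x ｝ <ˢ G

  Below Above Incomparable : Pred P 0ℓ → Pred P 0ℓ
  Below        K x = ｛ x ｝ <ˢ K
  Above        K x = K <ˢ ｛ x ｝
  Incomparable K x = x ∥ˢ K

  U1 : Cardinal → Set₁
  U1 κ = ∀ L G → NonemptySmall κ L → NonemptySmall κ G → L <ˢ G →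
         ∃[ x ] x ∈ Between L G

  U2 : Cardinal → Set₁
  U2 κ = ∀ K → NonemptySmall κ K →
         ∃[ x ] ∃[ y ] ∃[ z ] x ∈ Below K × y ∈ Above K × z ∈ Incomparable K

  IsAutomorphism : (P → P) → Set
  IsAutomorphism = IsOrderIsomorphism _≡_ _≡_ _<_ _<_

  Reversible : Set
  Reversible = ∀ (F : P → P) → IsOrderHomomorphism _≡_ _≡_ _<_ _<_ F →
               Bijective _≡_ _≡_ F → IsAutomorphism F

  IsSubstructureIso : (A B : Pred P 0ℓ) → (⟪ A ⟫ → ⟪ B ⟫) → Set
  IsSubstructureIso A B = IsOrderIsomorphism _≡_ _≡_ (_<_ on value) (_<_ on value)

  Homogeneous : Cardinal → Set₁
  Homogeneous κ = ∀ A B → ∣ ⟪ A ⟫ ∣≺ κ → ∣ ⟪ B ⟫ ∣≺ κ →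
    ∀ (f : ⟪ A ⟫ → ⟪ B ⟫) → IsSubstructureIso A B f →
    ∃[ F ] IsAutomorphism F × (∀ a → F (value a) ≡ value (f a))

  Universal : Cardinal → Set₁
  Universal κ = ∀ (ℚ : StrictPoset) → let open StrictPoset ℚ renaming (Carrier to Q; _<_ to _<′_) in
    ∣ Q ∣≼ κ → ∃[ e ] IsOrderMonomorphism _≡_ _≡_ _<′_ _<_ e

  HomogeneousUniversal : Cardinal → Set₁
  HomogeneousUniversal κ = ∣ P ∣≡ κ × Homogeneous κ × Universal κ

  IsCountableRandomPoset : Set₁
  IsCountableRandomPoset = HomogeneousUniversal ω

{-# OPTIONS --safe #-}

-- For (a) and (b), a small set of solutions would admit one more solution
-- strictly above, strictly below or incomparable with all of them, which is
-- itself one of them.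
--
-- For (c), when κ is regular a set is small iff its ranks are bounded, so the
-- stages of a recursion of length κ stay small.  A back-and-forth of
-- order-preserving partial injections never gets stuck: going forth, (u1)
-- with (a), or (u2), provides a fresh value in the required interval; going
-- back, (u2) provides a preimage incomparable with everything used so far.
-- Started from a map sending an incomparable pair to a comparable one, it
-- produces a bijective endomorphism which is not an automorphism.
--
-- For (d), a one-point extension of ℙ embeds in ℙ by universality, and
-- homogeneity moves the copy of a small set back to the set itself; this
-- gives (u1) and (u2).
module Submission where

open import Axiom.ExcludedMiddle using (ExcludedMiddle)
open import Data.Empty using (⊥; ⊥-elim)
open import Data.Fin.Base using (Fin; zero; suc)
open import Data.Fin.Properties using (ℕ→Fin-notInjective)
open import Data.Irrelevant using ([_])
open import Data.Maybe.Base using (Maybe; just; nothing)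
import Data.Maybe.Base as Maybe
import Data.Maybe.Properties as Maybe
open import Data.Nat.Base as ℕ using (ℕ; zero; suc)
import Data.Nat.Properties as ℕ
open import Data.Nat.GeneralisedArithmetic using (fold)
open import Data.Product using (_×_; _,_; proj₁; proj₂; ∃-syntax)
open import Data.Refinement.Base using (value) renaming (_,_ to _,ʳ_)
open import Data.Refinement.Properties using (value-injective)
open import Data.Sum.Base using (_⊎_; inj₁; inj₂; [_,_]′)
open import Data.Unit.Base using (tt)
open import Data.Vec.Base using (Vec; []; _∷_; lookup)
open import Function.Base using (id; _∘_)
open import Function.Bundles
  using (_↣_; _⤖_; mk↣; mk⤖; module Injection; module Bijection; module Inverse)
open import Function.Construct.Composition using (_↣-∘_; _⤖-∘_)
open import Function.Definitions using (Injective; Surjective; Bijective)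
open import Function.Properties.Bijection using (⤖⇒↔)
open import Function.Properties.Inverse using (↔⇒⤖; ↔-sym)
open import Induction.WellFounded using (module All; module FixPoint)
open import Level using (0ℓ)
open import Relation.Binary.Core using (Rel)
open import Relation.Binary.Definitions using (Irreflexive; Transitive; Tri; tri<; tri≈; tri>)
open import Relation.Binary.Morphism.Structures
  using (IsOrderHomomorphism; IsOrderMonomorphism; IsOrderIsomorphism)
open import Relation.Binary.PropositionalEquality
  using (_≡_; _≢_; refl; sym; trans; cong; subst; subst₂; resp₂; isEquivalence)
open import Relation.Binary.Structures using (IsStrictPartialOrder; IsStrictTotalOrder)
open import Relation.Nullary.Decidable using (Dec; yes; no; recompute; decidable-stable)
open import Relation.Nullary.Negation using (¬_)
open import Relation.Unary using (Pred; _∈_; _∉_; _⊆_; _∪_; ∅; U; ｛_｝; Satisfiable)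
open import Defs

-- Bijections and extensional choice.

bijection⁻¹ : {A B : Set} → A ⤖ B → B ↣ A
bijection⁻¹ b = mk↣ {to = from} λ {x} {y} eq →
  trans (sym (strictlyInverseˡ x)) (trans (cong to eq) (strictlyInverseˡ y))
  where open Inverse (⤖⇒↔ b)

-- A Hilbert epsilon operator for `Z` that cannot tell equivalent predicates apart.
record Selector (Z : Set) : Set₁ where
  field
    select      : Pred Z 0ℓ → Z
    select-sat  : ∀ {Φ} → Satisfiable Φ → Φ (select Φ)
    select-cong : ∀ {Φ Ψ} → Φ ⊆ Ψ → Ψ ⊆ Φ → select Φ ≡ select Ψ

open Selector

-- Lets a ranking of `P` alone serve for choosing pairs: the second coordinate is taken from the
-- fibre over the first.
×-selector : {Y Z : Set} → Selector Y → Selector Z → Selector (Y × Z)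
×-selector {Y} {Z} σ τ = record
  { select      = λ Φ → fst Φ , snd Φ
  ; select-sat  = λ { {Φ} ((y , z) , p) →
      select-sat τ (select-sat σ {λ y → ∃[ z ] Φ (y , z)} (y , z , p)) }
  ; select-cong = congruent
  }
  where
  fst : Pred (Y × Z) 0ℓ → Y
  fst Φ = select σ λ y → ∃[ z ] Φ (y , z)

  snd : Pred (Y × Z) 0ℓ → Z
  snd Φ = select τ λ z → Φ (fst Φ , z)

  congruent : ∀ {Φ Ψ} → Φ ⊆ Ψ → Ψ ⊆ Φ → (fst Φ , snd Φ) ≡ (fst Ψ , snd Ψ)
  congruent {Φ} {Ψ} Φ⊆Ψ Ψ⊆Φ
    with fst Φ | fst Ψ | select-cong σ {λ y → ∃[ z ] Φ (y , z)} {λ y → ∃[ z ] Ψ (y , z)}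
                           (λ (z , p) → z , Φ⊆Ψ p) (λ (z , p) → z , Ψ⊆Φ p)
  ... | y | .y | refl = cong (y ,_) (select-cong τ Φ⊆Ψ Ψ⊆Φ)

-- Membership proofs and Cantor-Bernstein.

module Classical (em : ExcludedMiddle 0ℓ) where

  -- Excluded middle decides `C`, so the irrelevant membership proof can be recomputed into a usable
  -- one.
  member : {A : Set} {C : Pred A 0ℓ} (c : ⟪ C ⟫) → C (value c)
  member (_ ,ʳ [ p ]) = recompute em p

  -- The Cantor–Bernstein argument: the bijection is f on the f-orbits of the
  -- points outside C, and the identity elsewhere.
  cantorBernstein : {A : Set} (C : Pred A 0ℓ) → A ↣ ⟪ C ⟫ → A ⤖ ⟪ C ⟫
  cantorBernstein {A} C ι = mk⤖ {to = h}
    (injective _ _ em em ∘ cong value , λ c → surjective c em)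
    where
    f : A → A
    f = value ∘ Injection.to ι

    Orbit : Pred A 0ℓ
    Orbit x = ∃[ n ] ∃[ c ] c ∉ C × fold c f n ≡ x

    outside : ∀ {x} → ¬ Orbit x → C x
    outside ¬o = decidable-stable em λ x∉C → ¬o (0 , _ , x∉C , refl)

    step : ∀ {x} → Orbit x → Orbit (f x)
    step (n , c , c∉C , eq) = suc n , c , c∉C , cong f eq

    -- The decision is an argument, so that proofs can case on it independently of `em`.
    h′ : ∀ x → Dec (Orbit x) → ⟪ C ⟫
    h′ x (yes _)  = Injection.to ι x
    h′ x (no ¬o) = x ,ʳ [ outside ¬o ]

    h : A → ⟪ C ⟫
    h x = h′ x (em {Orbit x})

    injective : ∀ x y (dx : Dec (Orbit x)) (dy : Dec (Orbit y)) →
                value (h′ x dx) ≡ value (h′ y dy) → x ≡ y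
    injective x y (yes _) (yes _) eq = Injection.injective ι (value-injective eq)
    injective x y (yes o) (no ¬o) eq = ⊥-elim (¬o (subst Orbit eq (step o)))
    injective x y (no ¬o) (yes o) eq = ⊥-elim (¬o (subst Orbit (sym eq) (step o)))
    injective x y (no _)  (no _)  eq = eq

    value-orbit : ∀ {x} (d : Dec (Orbit x)) → Orbit x → value (h′ x d) ≡ f x
    value-orbit (yes _) o = refl
    value-orbit (no ¬o) o = ⊥-elim (¬o o)

    value-¬orbit : ∀ {x} (d : Dec (Orbit x)) → ¬ Orbit x → value (h′ x d) ≡ x
    value-¬orbit (yes o) ¬o = ⊥-elim (¬o o)
    value-¬orbit (no _)  ¬o = refl

    surjective : ∀ c → Dec (Orbit (value c)) → ∃[ x ] (∀ {z} → z ≡ x → h z ≡ c)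
    -- A point of `C` on an orbit is not its start, which lies outside `C`; so it has a preceding
    -- orbit point, and that is its preimage.
    surjective c (yes (zero , _ , x∉C , refl)) = ⊥-elim (x∉C (member c))
    surjective c (yes (suc n , x , x∉C , eq)) =
      fold x f n ,
      λ { refl → value-injective (trans (value-orbit em (n , x , x∉C , refl)) eq) }
    surjective c (no ¬o) =
      value c , λ { refl → value-injective (value-¬orbit em ¬o) }

  -- Cardinals: least elements, choice and transfinite recursion.

  module CardinalProperties (κ : Cardinal) where
    open Cardinal κ renaming (Carrier to ∣κ∣; _<_ to _≺_; _≤_ to _≼_)
    open IsStrictTotalOrder isStrictTotalOrder
      using (compare) renaming (trans to ≺-trans)

    Least : Pred ∣κ∣ 0ℓ → Pred ∣κ∣ 0ℓ
    Least Φ α = Φ α × (∀ β → Φ β → ¬ (β ≺ α))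

    least : ∀ {Φ} → Satisfiable Φ → Satisfiable (Least Φ)
    least {Φ} (α , p) =
      All.wfRec wellFounded 0ℓ (λ α → Φ α → Satisfiable (Least Φ)) search α p
      where
      search : ∀ α → (∀ {β} → β ≺ α → Φ β → Satisfiable (Least Φ)) →
               Φ α → Satisfiable (Least Φ)
      search α IH p with em {∃[ β ] Φ β × β ≺ α}
      ... | yes (β , q , β≺α) = IH β≺α q
      ... | no none = α , p , λ β q β≺α → none (β , q , β≺α)

    least-unique : ∀ {Φ Ψ α β} → Φ ⊆ Ψ → Ψ ⊆ Φ → Least Φ α → Least Ψ β → α ≡ β
    least-unique {α = α} {β} Φ⊆Ψ Ψ⊆Φ (p , min) (q , min′) with compare α β
    ... | tri< α≺β _ _ = ⊥-elim (min′ α (Φ⊆Ψ p) α≺β)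
    ... | tri≈ _ α≡β _ = α≡β
    ... | tri> _ _ β≺α = ⊥-elim (min β (Ψ⊆Φ q) β≺α)

    -- The element of least rank depends only on the extension of the predicate, because `ρ` is
    -- injective. `z₀` is the default when nothing satisfies it.
    selector : {Z : Set} → Z → Z ↣ ∣κ∣ → Selector Z
    selector {Z} z₀ ρ = record
      { select      = λ Φ → choose Φ em
      ; select-sat  = λ {Φ} → choose-sat Φ em
      ; select-cong = λ {Φ} {Ψ} Φ⊆Ψ Ψ⊆Φ → choose-cong Φ Ψ Φ⊆Ψ Ψ⊆Φ em em
      }
      where
      rank : Z → ∣κ∣
      rank = Injection.to ρ

      Ranks : Pred Z 0ℓ → Pred ∣κ∣ 0ℓ
      Ranks Φ α = ∃[ z ] Φ z × rank z ≡ α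

      leastRanked : ∀ {Φ} → Satisfiable Φ → ∃[ z ] Φ z × Least (Ranks Φ) (rank z)
      leastRanked {Φ} (z , p) with least {Ranks Φ} (rank z , z , p , refl)
      ... | _ , l@((z′ , p′ , refl) , _) = z′ , p′ , l

      choose : ∀ Φ → Dec (Satisfiable Φ) → Z
      choose Φ (yes s) = proj₁ (leastRanked {Φ} s)
      choose Φ (no _)  = z₀

      choose-sat : ∀ Φ d → Satisfiable Φ → Φ (choose Φ d)
      choose-sat Φ (yes s) _ = proj₁ (proj₂ (leastRanked {Φ} s))
      choose-sat Φ (no ¬s) s = ⊥-elim (¬s s)

      choose-cong : ∀ Φ Ψ → Φ ⊆ Ψ → Ψ ⊆ Φ → ∀ d d′ → choose Φ d ≡ choose Ψ d′
      choose-cong Φ Ψ Φ⊆Ψ Ψ⊆Φ (yes s) (yes s′) = Injection.injective ρ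
        (least-unique {Ranks Φ} {Ranks Ψ}
          (λ (z , p , e) → z , Φ⊆Ψ p , e) (λ (z , p , e) → z , Ψ⊆Φ p , e)
          (proj₂ (proj₂ (leastRanked {Φ} s))) (proj₂ (proj₂ (leastRanked {Ψ} s′))))
      choose-cong Φ Ψ Φ⊆Ψ Ψ⊆Φ (yes (z , p)) (no ¬s) = ⊥-elim (¬s (z , Φ⊆Ψ p))
      choose-cong Φ Ψ Φ⊆Ψ Ψ⊆Φ (no ¬s) (yes (z , p)) = ⊥-elim (¬s (z , Ψ⊆Φ p))
      choose-cong Φ Ψ Φ⊆Ψ Ψ⊆Φ (no _) (no _) = refl

    -- Hilbert's hotel: a copy of ℕ is shifted by one to make room for `nothing`. This bounds the
    -- size of a one-point extension of ℙ.
    maybe-↣ : Infinite κ → Maybe ∣κ∣ ↣ ∣κ∣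
    maybe-↣ ι = mk↣ {to = h} λ {x} {y} → injective x y
      where
      point : ℕ → ∣κ∣
      point = Injection.to ι

      InRange : Pred ∣κ∣ 0ℓ
      InRange α = ∃[ n ] point n ≡ α

      shift : ∀ α → Dec (InRange α) → ∣κ∣
      shift α (yes (n , _)) = point (suc n)
      shift α (no _)        = α

      h : Maybe ∣κ∣ → ∣κ∣
      h nothing  = point 0
      h (just α) = shift α em

      shift≢0 : ∀ α d → point 0 ≢ shift α d
      shift≢0 α (yes _)  eq with () ← Injection.injective ι eq
      shift≢0 α (no α∉) eq = α∉ (0 , eq)

      shift-injective : ∀ α β d e → shift α d ≡ shift β e → α ≡ β
      shift-injective α β (yes (m , refl)) (yes (n , refl)) eq =
        cong point (ℕ.suc-injective (Injection.injective ι eq))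
      shift-injective α β (yes (m , _)) (no β∉) eq = ⊥-elim (β∉ (suc m , eq))
      shift-injective α β (no α∉) (yes (n , _)) eq = ⊥-elim (α∉ (suc n , sym eq))
      shift-injective α β (no _)  (no _)        eq = eq

      injective : ∀ x y → h x ≡ h y → x ≡ y
      injective nothing  nothing  eq = refl
      injective nothing  (just β) eq = ⊥-elim (shift≢0 β em eq)
      injective (just α) nothing  eq = ⊥-elim (shift≢0 α em (sym eq))
      injective (just α) (just β) eq = cong just (shift-injective α β em em eq)

    History : Set → ∣κ∣ → Set
    History Z α = ∀ {β} → β ≺ α → Z

    -- A selector makes the recursive choice independent of accessibility
    -- proofs, which is what FixPoint needs in the absence of function
    -- extensionality.
    transfiniteChoice : {Z : Set} → Selector Z →
      (Good : ∀ α → History Z α → Pred Z 0ℓ) →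
      (∀ {α} {h h′ : History Z α} → (∀ {β} (β≺α : β ≺ α) → h β≺α ≡ h′ β≺α) →
         Good α h ⊆ Good α h′) →
      (∀ α (f : ∣κ∣ → Z) → (∀ {β} → β ≺ α → Good β (λ {γ} _ → f γ) (f β)) →
         Satisfiable (Good α (λ {β} _ → f β))) →
      ∃[ f ] ∀ α → Good α (λ {β} _ → f β) (f α)
    transfiniteChoice {Z} σ Good Good-resp extend =
      f , All.wfRec wellFounded 0ℓ (λ α → Good α (λ {β} _ → f β) (f α))
            λ α IH → subst (Good α (λ {β} _ → f β)) (sym unfold-wfRec)
                       (select-sat σ (extend α f IH))
      where
      stage : ∀ α → History Z α → Z
      stage α h = select σ (Good α h)

      open FixPoint wellFounded (λ _ → Z) stage
        (λ α h≗h′ → select-cong σ (Good-resp h≗h′) (Good-resp (sym ∘ h≗h′)))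

      f : ∣κ∣ → Z
      f = All.wfRec wellFounded 0ℓ (λ _ → Z) stage

    -- Bounded sets and smallness.

    noInjectionIntoSegment : ∀ α (f : ∣κ∣ ↣ ∣κ∣) → ¬ (∀ β → Injection.to f β ≺ α)
    -- Cantor-Bernstein would make the segment equinumerous with κ, which `initial` forbids.
    noInjectionIntoSegment α f f≺α = initial α (cantorBernstein (_≺ α)
      (mk↣ {to = λ β → Injection.to f β ,ʳ [ f≺α β ]} (Injection.injective f ∘ cong value)))

    -- The inverse of a bijection with κ, followed by `h`, would inject κ into the segment below
    -- `γ`.
    boundedInjection⇒small : {X : Set} (h : X ↣ ∣κ∣) → ∀ γ →
      (∀ x → Injection.to h x ≺ γ) → ∣ X ∣≺ κ
    boundedInjection⇒small h γ h≺γ =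
      h , λ b → noInjectionIntoSegment γ (h ↣-∘ bijection⁻¹ b) λ β → h≺γ _

    Bounded : Pred ∣κ∣ 0ℓ → Set
    Bounded C = ∃[ γ ] ∀ {β} → β ∈ C → β ≺ γ

    module RegularProperties (regular : Regular κ) where

      -- By trichotomy a set without a strict upper bound is cofinal, and regularity forbids a small
      -- cofinal set.
      small⇒bounded : ∀ C → ∣ ⟪ C ⟫ ∣≺ κ → Bounded C
      small⇒bounded C small = decidable-stable em λ unbounded →
        regular C (cofinal unbounded) small
        where
        cofinal : ¬ Bounded C → Cofinal κ C
        cofinal unbounded α = decidable-stable em λ none →
          unbounded (α , λ {β} β∈C → below none β∈C (compare β α))
          where
          below : ¬ (∃[ β ] β ∈ C × α ≼ β) → ∀ {β} → β ∈ C → Tri (β ≺ α) (β ≡ α) (α ≺ β) → β ≺ α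
          below none β∈C (tri< β≺α _ _)  = β≺α
          below none β∈C (tri≈ _ refl _) = ⊥-elim (none (_ , β∈C , inj₂ refl))
          below none β∈C (tri> _ _ α≺β)  = ⊥-elim (none (_ , β∈C , inj₁ α≺β))

      -- Choosing preimages injects the image into the segment below `α`, so it is small and
      -- regularity bounds it.
      segmentImage-bounded : ∀ (g : ∣κ∣ → ∣κ∣) α →
                             Bounded λ γ → ∃[ β ] β ≺ α × g β ≡ γ
      segmentImage-bounded g α = small⇒bounded Image
        (boundedInjection⇒small (mk↣ {to = preimage} injective) α
          (proj₁ ∘ proj₂ ∘ member {C = Image}))
        where
        Image : Pred ∣κ∣ 0ℓ
        Image γ = ∃[ β ] β ≺ α × g β ≡ γ

        preimage : ⟪ Image ⟫ → ∣κ∣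
        preimage = proj₁ ∘ member {C = Image}

        injective : Injective _≡_ _≡_ preimage
        injective {c} {c′} eq = value-injective
          (trans (sym (proj₂ (proj₂ (member {C = Image} c))))
            (trans (cong g eq) (proj₂ (proj₂ (member {C = Image} c′)))))

    ∪-bounded : ∀ {C D} → Bounded C → Bounded D → Bounded (C ∪ D)
    ∪-bounded (γ , C≺γ) (δ , D≺δ) with compare γ δ
    ... | tri< γ≺δ _ _  = δ , [ (λ c → ≺-trans (C≺γ c) γ≺δ) , D≺δ ]′
    ... | tri≈ _ refl _ = γ , [ C≺γ , D≺δ ]′
    ... | tri> _ _ δ≺γ  = γ , [ C≺γ , (λ d → ≺-trans (D≺δ d) δ≺γ) ]′

    -- Posets of size κ: ranks and finite subsets.

    module PosetProperties (infinite : Infinite κ) (ℙ : StrictPoset)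
                           (size : StrictPoset.Carrier ℙ ⤖ ∣κ∣) where
      open Order ℙ
      open StrictPoset ℙ using (isStrictPartialOrder)
      open IsStrictPartialOrder isStrictPartialOrder
        using () renaming (trans to <-trans; irrefl to <-irrefl)

      rank : P → ∣κ∣
      rank = Bijection.to size

      ranking : P ↣ ∣κ∣
      ranking = Bijection.injection size

      unrank : ∣κ∣ → P
      unrank = Inverse.from (⤖⇒↔ size)

      rank-unrank : ∀ α → rank (unrank α) ≡ α
      rank-unrank = Inverse.strictlyInverseˡ (⤖⇒↔ size)

      unrank-rank : ∀ p → unrank (rank p) ≡ p
      unrank-rank = Inverse.strictlyInverseʳ (⤖⇒↔ size)

      subsetRanking : ∀ K → ⟪ K ⟫ ↣ ∣κ∣
      subsetRanking K = ranking ↣-∘ mk↣ {to = value} value-injective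

      ¬small⇒full : ∀ {K} → ¬ (∣ ⟪ K ⟫ ∣≺ κ) → ∣ ⟪ K ⟫ ∣≡ κ
      ¬small⇒full {K} ¬small = decidable-stable em λ ¬full →
        ¬small (subsetRanking K , ¬full)

      Range : ∀ {n} → Vec P n → Pred P 0ℓ
      Range ps p = ∃[ i ] lookup ps i ≡ p

      -- Equinumerosity with κ would carry the copy of ℕ in κ injectively into `Fin n`.
      range-small : ∀ {n} (ps : Vec P n) → ∣ ⟪ Range ps ⟫ ∣≺ κ
      range-small {n} ps = subsetRanking (Range ps) , λ b →
        let g = index ↣-∘ (bijection⁻¹ b ↣-∘ infinite)
        in ℕ→Fin-notInjective (Injection.to g) (Injection.injective g)
        where
        index : ⟪ Range ps ⟫ ↣ Fin n
        index = mk↣ {to = proj₁ ∘ member {C = Range ps}} λ {c} {c′} eq → value-injective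
          (trans (sym (proj₂ (member {C = Range ps} c)))
            (trans (cong (lookup ps) eq) (proj₂ (member {C = Range ps} c′))))

      range-nonemptySmall : ∀ {n} (ps : Vec P (suc n)) → NonemptySmall κ (Range ps)
      range-nonemptySmall ps = (lookup ps zero , zero , refl) , range-small ps

      -- `w < k` would give `w < y`, and `k < w` would give `x < w`. Two bounds of a set can thus
      -- stand for the whole set.
      ∥-squeeze : ∀ {w x y k} → x < k → k < y → w ∥ x → w ∥ y → w ∥ k
      ∥-squeeze {w} {x} {y} {k} x<k k<y (_ , x≰w) (w≰y , _) =
        (λ { (inj₁ w<k) → w≰y (inj₁ (<-trans w<k k<y)) ; (inj₂ refl) → w≰y (inj₁ k<y) }) ,
        (λ { (inj₁ k<w) → x≰w (inj₁ (<-trans x<k k<w)) ; (inj₂ refl) → x≰w (inj₁ x<k) })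

      -- Solution sets have size κ.

      module Dense (u1 : U1 κ) (u2 : U2 κ) where

        between-full : ∀ {L G} → NonemptySmall κ L → NonemptySmall κ G → L <ˢ G →
                       ∣ ⟪ Between L G ⟫ ∣≡ κ
        between-full {L} {G} l g L<G = ¬small⇒full λ small →
          let b , L<b , b<G = u1 L G l g L<G
              -- (u1) with the solution set in place of `G`: `x` is below the solution `b`, hence
              -- below `G`, hence itself a solution.
              x , L<x , x<B = u1 L (Between L G) l ((b , L<b , b<G) , small)
                                λ a c a∈L (L<c , _) → L<c a c a∈L refl
              x<b = x<B x b refl (L<b , b<G)
              x∈B = L<x , λ { a c refl c∈G → <-trans x<b (b<G b c refl c∈G) }
          in <-irrefl refl (x<B x x refl x∈B)

        below-full : ∀ {K} → NonemptySmall κ K → ∣ ⟪ Below K ⟫ ∣≡ κ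
        below-full {K} K-small = ¬small⇒full λ small →
          let b , _ , _ , b<K , _ = u2 K K-small
              x , _ , _ , x<B , _ = u2 (Below K) ((b , b<K) , small)
              x∈B = λ { a c refl c∈K → <-trans (x<B x b refl b<K) (b<K b c refl c∈K) }
          in <-irrefl refl (x<B x x refl x∈B)

        above-full : ∀ {K} → NonemptySmall κ K → ∣ ⟪ Above K ⟫ ∣≡ κ
        above-full {K} K-small = ¬small⇒full λ small →
          let _ , b , _ , _ , K<b , _ = u2 K K-small
              _ , x , _ , _ , A<x , _ = u2 (Above K) ((b , K<b) , small)
              x∈A = λ { c a c∈K refl → <-trans (K<b c b c∈K refl) (A<x b x K<b refl) }
          in <-irrefl refl (A<x x x x∈A refl)

        incomparable-full : ∀ {K} → NonemptySmall κ K → ∣ ⟪ Incomparable K ⟫ ∣≡ κ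
        incomparable-full {K} K-small = ¬small⇒full λ small →
          let x  , y  , z , x<K  , y>K  , z∥K = u2 K K-small
              x′ , y′ , _ , x′<Z , y′>Z , _   = u2 (Incomparable K) ((z , z∥K) , small)
              -- A `w` incomparable with `x` and `y` is incomparable with `K`, so it is a solution.
              -- Incomparability with `x′` and `y′`, which bound all solutions, then makes it
              -- incomparable with itself.
              F = x ∷ y ∷ x′ ∷ y′ ∷ []
              _ , _ , w , _ , _ , w∥F = u2 (Range F) (range-nonemptySmall F)
              w∥ = λ i → w∥F (lookup F i) (i , refl)
              w∥K : w ∥ˢ K
              w∥K k k∈K = ∥-squeeze (x<K x k refl k∈K) (y>K k y k∈K refl)
                            (w∥ zero) (w∥ (suc zero))
              w∥w = ∥-squeeze (x′<Z x′ w refl w∥K) (y′>Z w y′ w∥K refl)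
                      (w∥ (suc (suc zero))) (w∥ (suc (suc (suc zero))))
          in proj₁ w∥w (inj₂ refl)

      -- One-point extensions and their realization in ℙ.

      module OnePointExtension
        (D E : Pred P 0ℓ)
        (D-down : ∀ {p q} → p < q → D q → D p)
        (E-up : ∀ {p q} → p < q → E p → E q)
        (D<E : D <ˢ E) where

        infix 4 _◁_

        _◁_ : Rel (Maybe P) 0ℓ
        just p  ◁ just q  = p < q
        just p  ◁ nothing = D p
        nothing ◁ just q  = E q
        nothing ◁ nothing = ⊥

        ◁-trans : Transitive _◁_
        ◁-trans {just _}  {just _}  {just _}  p<q q<r = <-trans p<q q<r
        ◁-trans {just _}  {just _}  {nothing} p<q q∈D = D-down p<q q∈D
        ◁-trans {just _}  {nothing} {just _}  p∈D r∈E = D<E _ _ p∈D r∈E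
        ◁-trans {nothing} {just _}  {just _}  q∈E q<r = E-up q<r q∈E
        ◁-trans {nothing} {just _}  {nothing} q∈E q∈D = <-irrefl refl (D<E _ _ q∈D q∈E)

        ◁-irrefl : Irreflexive _≡_ _◁_
        ◁-irrefl {just _} refl p<p = <-irrefl refl p<p

        extension : StrictPoset
        extension = record
          { Carrier = Maybe P
          ; _<_     = _◁_
          ; isStrictPartialOrder = record
            { isEquivalence = isEquivalence
            ; irrefl        = ◁-irrefl
            ; trans         = λ {x} {y} {z} → ◁-trans {x} {y} {z}
            ; <-resp-≈      = resp₂ _◁_
            }
          }

        module _ (homogeneous : Homogeneous κ) (universal : Universal κ) where

          -- Universality embeds the extension by `e`, and homogeneity extends `k ↦ e (just k)` on
          -- `K` to an automorphism `F`. The `F`-preimage of `e nothing` then sits over `K` as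
          -- `nothing` does.
          realized : ∀ K → ∣ ⟪ K ⟫ ∣≺ κ → ∃[ x ] ∀ {k} → k ∈ K →
            (D k → k < x) × (E k → x < k) × (k ≤ x → D k) × (x ≤ k → E k)
          realized K small@(_ , ¬full) = x , λ {k} k∈K →
            (λ k∈D → F.cancel (subst₂ _<_ (F≡e k∈K) (sym Fx) (e.mono {just k} {nothing} k∈D))) ,
            (λ k∈E → F.cancel (subst₂ _<_ (sym Fx) (F≡e k∈K) (e.mono {nothing} {just k} k∈E))) ,
            (λ { (inj₁ k<x) → e.cancel {just k} {nothing}
                                (subst₂ _<_ (sym (F≡e k∈K)) Fx (F.mono k<x))
               ; (inj₂ refl) → ⊥-elim (x∉K k∈K) }) ,
            (λ { (inj₁ x<k) → e.cancel {nothing} {just k}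
                                (subst₂ _<_ Fx (sym (F≡e k∈K)) (F.mono x<k))
               ; (inj₂ refl) → ⊥-elim (x∉K k∈K) })
            where
            embedding = universal extension
              (maybe-↣ infinite ↣-∘ mk↣ {to = Maybe.map rank}
                (Maybe.map-injective (Injection.injective ranking)))

            e : Maybe P → P
            e = proj₁ embedding

            module e = IsOrderMonomorphism (proj₂ embedding)

            Image : Pred P 0ℓ
            Image q = ∃[ k ] k ∈ K × e (just k) ≡ q

            f : ⟪ K ⟫ → ⟪ Image ⟫
            f c = e (just (value c)) ,ʳ [ (value c , member c , refl) ]

            f-injective : Injective _≡_ _≡_ f
            f-injective eq =
              value-injective (Maybe.just-injective (e.injective (cong value eq)))

            f-surjective : Surjective _≡_ _≡_ f
            f-surjective c = let k , k∈K , eq = member {C = Image} c in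
              (k ,ʳ [ k∈K ]) , λ { refl → value-injective eq }

            f-iso : IsSubstructureIso K Image f
            f-iso = record
              { isOrderMonomorphism = record
                { isOrderHomomorphism = record
                  { cong = cong f
                  ; mono = λ {c} {d} → e.mono {just (value c)} {just (value d)}
                  }
                ; injective = f-injective
                ; cancel    = λ {c} {d} → e.cancel {just (value c)} {just (value d)}
                }
              ; surjective = f-surjective
              }

            automorphism = homogeneous K Image small
              (subsetRanking Image ,
               λ b → ¬full (b ⤖-∘ mk⤖ {to = f} (f-injective , f-surjective)))
              f f-iso

            F : P → P
            F = proj₁ automorphism

            module F = IsOrderIsomorphism (proj₁ (proj₂ automorphism))

            F≡e : ∀ {k} → k ∈ K → e (just k) ≡ F k
            F≡e {k} k∈K = sym (proj₂ (proj₂ automorphism) (k ,ʳ [ k∈K ]))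

            x : P
            x = proj₁ (F.surjective (e nothing))

            Fx : F x ≡ e nothing
            Fx = proj₂ (F.surjective (e nothing)) refl

            x∉K : x ∉ K
            x∉K x∈K with () ← e.injective (trans (F≡e x∈K) Fx)

      -- Coherent partial maps.

      dom ran : Pred (P × P) 0ℓ → Pred P 0ℓ
      dom S x = ∃[ y ] S (x , y)
      ran S y = ∃[ x ] S (x , y)

      -- Stated for two pairs at a time, so that coherence of a union of stages reduces to comparing
      -- two stages. The order is preserved but may fail to be reflected.
      record Compatible (s t : P × P) : Set where
        field
          monotone   : proj₁ s < proj₁ t → proj₂ s < proj₂ t
          functional : proj₁ s ≡ proj₁ t → proj₂ s ≡ proj₂ t
          injective  : proj₂ s ≡ proj₂ t → proj₁ s ≡ proj₁ t

      open Compatible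

      Coherent : Pred (P × P) 0ℓ → Set
      Coherent S = ∀ {s t} → s ∈ S → t ∈ S → Compatible s t

      coherent-⊆ : ∀ {S T} → S ⊆ T → Coherent T → Coherent S
      coherent-⊆ S⊆T coh s∈S t∈S = coh (S⊆T s∈S) (S⊆T t∈S)

      coherent-∪-member : ∀ {S t} → Coherent S → t ∈ S → Coherent (S ∪ ｛ t ｝)
      coherent-∪-member {S} coh t∈S =
        coherent-⊆ {T = S} (λ { (inj₁ s∈S) → s∈S ; (inj₂ refl) → t∈S }) coh

      -- Freshness of `x` and `y` makes the functional and injective clauses vacuous against old
      -- pairs, which leaves monotonicity.
      adjoin : ∀ {S x y} → Coherent S → x ∉ dom S → y ∉ ran S →
               (∀ {u v} → (u , v) ∈ S → u < x → v < y) →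
               (∀ {u v} → (u , v) ∈ S → x < u → y < v) →
               Coherent (S ∪ ｛ x , y ｝)
      adjoin coh x∉ y∉ lower upper (inj₁ s) (inj₁ t) = coh s t
      adjoin coh x∉ y∉ lower upper (inj₁ s) (inj₂ refl) = record
        { monotone   = lower s
        ; functional = λ { refl → ⊥-elim (x∉ (_ , s)) }
        ; injective  = λ { refl → ⊥-elim (y∉ (_ , s)) }
        }
      adjoin coh x∉ y∉ lower upper (inj₂ refl) (inj₁ t) = record
        { monotone   = upper t
        ; functional = λ { refl → ⊥-elim (x∉ (_ , t)) }
        ; injective  = λ { refl → ⊥-elim (y∉ (_ , t)) }
        }
      adjoin coh x∉ y∉ lower upper (inj₂ refl) (inj₂ refl) = record
        { monotone   = λ x<x → ⊥-elim (<-irrefl refl x<x)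
        ; functional = λ _ → refl
        ; injective  = λ _ → refl
        }

      -- Small sets as sets of bounded rank.

      module RegularPoset (regular : Regular κ) where
        open RegularProperties regular

        -- The working form of smallness: equivalent to it by the next two lemmas, and easily closed
        -- under subsets and finite unions.
        RankBounded : Pred P 0ℓ → Set
        RankBounded K = Bounded λ α → K (unrank α)

        rankBounded⇒small : ∀ K → RankBounded K → ∣ ⟪ K ⟫ ∣≺ κ
        rankBounded⇒small K (γ , bound) =
          boundedInjection⇒small (subsetRanking K) γ λ c →
            bound (subst K (sym (unrank-rank (value c))) (member c))

        small⇒rankBounded : ∀ K → ∣ ⟪ K ⟫ ∣≺ κ → RankBounded K
        small⇒rankBounded K (_ , ¬full) = small⇒bounded (λ α → K (unrank α))
          (mk↣ {to = value} value-injective , λ b → ¬full (b ⤖-∘ reindex))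
          where
          reindex : ⟪ K ⟫ ⤖ ⟪ (λ α → K (unrank α)) ⟫
          reindex = mk⤖
            {to = λ c → rank (value c) ,ʳ [ subst K (sym (unrank-rank (value c))) (member c) ]}
            ( (λ eq → value-injective (Injection.injective ranking (cong value eq)))
            , λ c → (unrank (value c) ,ʳ [ member c ]) ,
                    λ { refl → value-injective (rank-unrank (value c)) } )

        rankBounded-⊆ : ∀ {K M} → K ⊆ M → RankBounded M → RankBounded K
        rankBounded-⊆ K⊆M (γ , bound) = γ , λ k → bound (K⊆M k)

        segmentImage-rankBounded : ∀ (g : ∣κ∣ → P) α →
                                   RankBounded λ p → ∃[ β ] β ≺ α × g β ≡ p
        segmentImage-rankBounded g α = let γ , bound = segmentImage-bounded (rank ∘ g) α in
          γ , λ (β , β≺α , eq) → bound (β , β≺α , trans (cong rank eq) (rank-unrank _))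

        ∪-rankBounded : ∀ {K M} → RankBounded K → RankBounded M → RankBounded (K ∪ M)
        ∪-rankBounded {K} {M} = ∪-bounded {λ α → K (unrank α)} {λ α → M (unrank α)}

        range-rankBounded : ∀ {n} (ps : Vec P n) → RankBounded (Range ps)
        range-rankBounded ps = small⇒rankBounded (Range ps) (range-small ps)

        -- (u1) and (u2) from homogeneity and universality.

        module _ (homogeneous : Homogeneous κ) (universal : Universal κ) where

          homogeneousUniversal⇒U1 : U1 κ
          homogeneousUniversal⇒U1 L G (_ , L-small) (_ , G-small) L<G =
            let x , realizes = realized homogeneous universal (L ∪ G) L∪G-small
            in x , (λ { a _ a∈L refl → proj₁ (realizes (inj₁ a∈L)) (a , a∈L , inj₂ refl) }) ,
                   (λ { _ b refl b∈G →
                          proj₁ (proj₂ (realizes (inj₂ b∈G))) (b , b∈G , inj₂ refl) })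
            where
            L∪G-small : ∣ ⟪ L ∪ G ⟫ ∣≺ κ
            L∪G-small = rankBounded⇒small (L ∪ G)
              (∪-rankBounded {L} {G} (small⇒rankBounded L L-small) (small⇒rankBounded G G-small))

            ≤<⇒< : ∀ {p q r} → p ≤ q → q < r → p < r
            ≤<⇒< (inj₁ p<q)  q<r = <-trans p<q q<r
            ≤<⇒< (inj₂ refl) q<r = q<r

            <≤⇒< : ∀ {p q r} → p < q → q ≤ r → p < r
            <≤⇒< p<q (inj₁ q<r)  = <-trans p<q q<r
            <≤⇒< p<q (inj₂ refl) = p<q

            -- The new point fills the cut between the downward closure of `L` and the upward
            -- closure of `G`.
            open OnePointExtension
              (λ p → ∃[ a ] a ∈ L × p ≤ a) (λ q → ∃[ b ] b ∈ G × b ≤ q)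
              (λ p<q (a , a∈L , q≤a) → a , a∈L , inj₁ (<≤⇒< p<q q≤a))
              (λ p<q (b , b∈G , b≤p) → b , b∈G , inj₁ (≤<⇒< b≤p p<q))
              (λ _ _ (a , a∈L , p≤a) (b , b∈G , b≤q) →
                 ≤<⇒< p≤a (<≤⇒< (L<G a b a∈L b∈G) b≤q))

          homogeneousUniversal⇒U2 : U2 κ
          homogeneousUniversal⇒U2 K (_ , small) =
            let x , x-bottom = Bottom.realized homogeneous universal K small
                y , y-top    = Top.realized homogeneous universal K small
                z , z-free   = Free.realized homogeneous universal K small
            in x , y , z ,
               (λ { _ k refl k∈K → proj₁ (proj₂ (x-bottom k∈K)) tt }) ,
               (λ { k _ k∈K refl → proj₁ (y-top k∈K) tt }) ,
               -- Incomparability comes from the converse implications of `realized`, whose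
               -- conclusions are empty here.
               (λ k k∈K → proj₂ (proj₂ (proj₂ (z-free k∈K))) , proj₁ (proj₂ (proj₂ (z-free k∈K))))
            where
            module Bottom = OnePointExtension ∅ U (λ _ ()) _ (λ _ _ ())
            module Top = OnePointExtension U ∅ _ (λ _ ()) (λ _ _ _ ())
            module Free = OnePointExtension ∅ ∅ (λ _ ()) (λ _ ()) (λ _ _ ())

        -- Back-and-forth steps.

        module BackAndForth (u1 : U1 κ) (u2 : U2 κ) where
          open Dense u1 u2

          -- If `B` contained every solution, the solution set would be small, against
          -- `between-full`.
          between-fresh : ∀ {L G B} → Satisfiable L → Satisfiable G → L <ˢ G →
                          L ⊆ B → G ⊆ B → RankBounded B →
                          ∃[ x ] x ∈ Between L G × x ∉ B
          between-fresh {L} {G} {B} l g L<G L⊆B G⊆B bounded = decidable-stable em λ none →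
            proj₂ (small λ {x} x∈ → decidable-stable em λ x∉B → none (x , x∈ , x∉B))
              (between-full (l , small L⊆B) (g , small G⊆B) L<G)
            where
            small : ∀ {K} → K ⊆ B → ∣ ⟪ K ⟫ ∣≺ κ
            small {K} K⊆B = rankBounded⇒small K (rankBounded-⊆ {K} {B} K⊆B bounded)

          forth : ∀ {S} → Coherent S → Satisfiable S → RankBounded (ran S) →
                  ∀ x → ∃[ y ] Coherent (S ∪ ｛ x , y ｝)
          forth {S} coh (s , s∈S) bounded x
            with em {x ∈ dom S}
          ... | yes (y , xy∈S) = y , coherent-∪-member coh xy∈S
          ... | no x∉ with u2 (ran S) ((_ , _ , s∈S) , rankBounded⇒small (ran S) bounded)
                         | em {Satisfiable L} | em {Satisfiable G}
            where
            L G : Pred P 0ℓ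
            L v = ∃[ u ] S (u , v) × u < x
            G v = ∃[ u ] S (u , v) × x < u
          -- No point of the domain exceeds `x`, so a `y` above the whole range is fresh and meets
          -- every constraint, whether or not `L` is empty.
          ...   | _ , y , _ , _ , y>S , _ | _ | no G-empty =
            y , adjoin coh x∉ (λ y∈ → <-irrefl refl (y>S y y y∈ refl))
              (λ uv _ → y>S _ y (_ , uv) refl)
              (λ uv x<u → ⊥-elim (G-empty (_ , _ , uv , x<u)))
          ...   | y , _ , _ , y<S , _ , _ | no L-empty | yes _ =
            y , adjoin coh x∉ (λ y∈ → <-irrefl refl (y<S y y refl y∈))
              (λ uv u<x → ⊥-elim (L-empty (_ , _ , uv , u<x)))
              (λ uv _ → y<S y _ refl (_ , uv))
          ...   | _ | yes l | yes g =
            let y , (L<y , y<G) , y∉ = between-fresh l g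
                  -- `L` lies below `G` because `u < x < u′` and the map is monotone on its domain.
                  (λ v v′ (u , uv , u<x) (u′ , uv′ , x<u′) →
                     monotone (coh uv uv′) (<-trans u<x x<u′))
                  (λ (u , uv , _) → u , uv) (λ (u , uv , _) → u , uv) bounded
            in y , adjoin coh x∉ y∉
                 (λ uv u<x → L<y _ y (_ , uv , u<x) refl)
                 (λ uv x<u → y<G y _ refl (_ , uv , x<u))

          -- A preimage incomparable with the whole domain is fresh and makes monotonicity vacuous;
          -- `y` may be comparable with old values, as order need not be reflected.
          back : ∀ {S} → Coherent S → Satisfiable S → RankBounded (dom S) →
                 ∀ y → ∃[ x ] Coherent (S ∪ ｛ x , y ｝)
          back {S} coh (s , s∈S) bounded y
            with em {y ∈ ran S}
          ... | yes (x , xy∈S) = x , coherent-∪-member coh xy∈S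
          ... | no y∉ =
            let _ , _ , x , _ , _ , x∥ =
                  u2 (dom S) ((_ , _ , s∈S) , rankBounded⇒small (dom S) bounded)
            in x , adjoin coh (λ x∈ → proj₁ (x∥ x x∈) (inj₂ refl)) y∉
                 (λ uv u<x → ⊥-elim (proj₂ (x∥ _ (_ , uv)) (inj₁ u<x)))
                 (λ uv x<u → ⊥-elim (proj₁ (x∥ _ (_ , uv)) (inj₁ x<u)))

          -- Transfinite construction of the bijection.

          module _ {a b c : P} (a∥b : a ∥ b) (a<c : a < c) where

            Initial : Pred (P × P) 0ℓ
            Initial = ｛ a , a ｝ ∪ ｛ b , c ｝

            initial-coherent : Coherent Initial
            initial-coherent = adjoin
              (λ { refl refl → record
                 { monotone = id ; functional = id ; injective = id } })
              (λ { (_ , refl) → proj₁ a∥b (inj₂ refl) })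
              (λ { (_ , refl) → <-irrefl refl a<c })
              (λ { refl _ → a<c })
              (λ { refl b<a → ⊥-elim (proj₂ a∥b (inj₁ b<a)) })

            -- One step forth and one step back: `y` is the image and `x` the preimage chosen for
            -- the element of rank `α`.
            Added : ∣κ∣ → P × P → Pred (P × P) 0ℓ
            Added α (y , x) = ｛ unrank α , y ｝ ∪ ｛ x , unrank α ｝

            -- `Φ` is a segment `_≺ α` during the recursion and `U` for the final union, so one
            -- coherence proof covers both.
            Stages : (Φ : Pred ∣κ∣ 0ℓ) → (∀ {β} → Φ β → P × P) → Pred (P × P) 0ℓ
            Stages Φ h t = t ∈ Initial ⊎ ∃[ β ] ∃[ φ ] t ∈ Added β (h {β} φ)

            Good : ∀ α → History (P × P) α → Pred (P × P) 0ℓ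
            Good α h z = Coherent (Stages (_≺ α) h ∪ Added α z)

            -- Any two pairs are present by the later of their stages, and goodness of that stage
            -- makes them compatible.
            stages-coherent : ∀ {Φ} (f : ∣κ∣ → P × P) →
              (∀ {α} → Φ α → Good α (λ {β} _ → f β) (f α)) →
              Coherent (Stages Φ λ {β} _ → f β)
            stages-coherent f good (inj₁ i) (inj₁ j) = initial-coherent i j
            stages-coherent f good (inj₁ i) (inj₂ (β , φ , t)) =
              good φ (inj₁ (inj₁ i)) (inj₂ t)
            stages-coherent f good (inj₂ (β , φ , t)) (inj₁ i) =
              good φ (inj₂ t) (inj₁ (inj₁ i))
            stages-coherent f good (inj₂ (β , φ , s)) (inj₂ (γ , ψ , t)) with compare β γ
            ... | tri< β≺γ _ _  = good ψ (inj₁ (inj₂ (β , β≺γ , s))) (inj₂ t)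
            ... | tri≈ _ refl _ = good ψ (inj₂ s) (inj₂ t)
            ... | tri> _ _ γ≺β  = good φ (inj₂ s) (inj₁ (inj₂ (γ , γ≺β , t)))

            good-resp : ∀ {α} {h h′ : History (P × P) α} →
              (∀ {β} (β≺α : β ≺ α) → h β≺α ≡ h′ β≺α) → Good α h ⊆ Good α h′
            good-resp {α} {h} {h′} h≗h′ {z} = coherent-⊆ λ
              { (inj₁ (inj₁ i)) → inj₁ (inj₁ i)
              ; (inj₁ (inj₂ (β , β≺α , t))) →
                  inj₁ (inj₂ (β , β≺α , subst (λ z → _ ∈ Added β z) (sym (h≗h′ β≺α)) t))
              ; (inj₂ t) → inj₂ t
              }

            extend : ∀ α (f : ∣κ∣ → P × P) →
              (∀ {β} → β ≺ α → Good β (λ {γ} _ → f γ) (f β)) →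
              Satisfiable (Good α λ {β} _ → f β)
            extend α f good =
              let y , coh′ = forth {S} (stages-coherent f good) (_ , inj₁ (inj₁ refl))
                               ran-bounded (unrank α)
                  x , coh″ = back {S ∪ ｛ unrank α , y ｝} coh′ (_ , inj₁ (inj₁ (inj₁ refl)))
                               (dom-∪-bounded y) (unrank α)
              in (y , x) , coherent-⊆
                   {T = (S ∪ ｛ unrank α , y ｝) ∪ ｛ x , unrank α ｝} (λ
                   { (inj₁ t) → inj₁ (inj₁ t)
                   ; (inj₂ (inj₁ t)) → inj₁ (inj₂ t)
                   ; (inj₂ (inj₂ t)) → inj₂ t
                   }) coh″
              where
              S : Pred (P × P) 0ℓ
              S = Stages (_≺ α) λ {β} _ → f β

              Image : (∣κ∣ → P) → Pred P 0ℓ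
              Image g p = ∃[ β ] β ≺ α × g β ≡ p

              -- Covers the coordinates used before stage `α`: those of the seed, those of rank
              -- below `α`, and the chosen ones. `g` picks out preimages for the domain and images
              -- for the range.
              Sources : (∣κ∣ → P) → Pred P 0ℓ
              Sources g = Range (a ∷ b ∷ c ∷ []) ∪ (Image unrank ∪ Image g)

              sources-bounded : ∀ g → RankBounded (Sources g)
              sources-bounded g =
                ∪-rankBounded {Range (a ∷ b ∷ c ∷ [])} {Image unrank ∪ Image g}
                  (range-rankBounded (a ∷ b ∷ c ∷ []))
                  (∪-rankBounded {Image unrank} {Image g}
                    (segmentImage-rankBounded unrank α) (segmentImage-rankBounded g α))

              dom-bounded : RankBounded (dom S)
              dom-bounded = rankBounded-⊆ {dom S} {Sources (proj₂ ∘ f)} (λ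
                { (_ , inj₁ (inj₁ refl)) → inj₁ (zero , refl)
                ; (_ , inj₁ (inj₂ refl)) → inj₁ (suc zero , refl)
                ; (_ , inj₂ (β , β≺α , inj₁ refl)) → inj₂ (inj₁ (β , β≺α , refl))
                ; (_ , inj₂ (β , β≺α , inj₂ refl)) → inj₂ (inj₂ (β , β≺α , refl))
                }) (sources-bounded (proj₂ ∘ f))

              ran-bounded : RankBounded (ran S)
              ran-bounded = rankBounded-⊆ {ran S} {Sources (proj₁ ∘ f)} (λ
                { (_ , inj₁ (inj₁ refl)) → inj₁ (zero , refl)
                ; (_ , inj₁ (inj₂ refl)) → inj₁ (suc (suc zero) , refl)
                ; (_ , inj₂ (β , β≺α , inj₁ refl)) → inj₂ (inj₂ (β , β≺α , refl))
                ; (_ , inj₂ (β , β≺α , inj₂ refl)) → inj₂ (inj₁ (β , β≺α , refl))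
                }) (sources-bounded (proj₁ ∘ f))

              dom-∪-bounded : ∀ y → RankBounded (dom (S ∪ ｛ unrank α , y ｝))
              dom-∪-bounded y =
                rankBounded-⊆ {dom (S ∪ ｛ unrank α , y ｝)} {dom S ∪ Range (unrank α ∷ [])}
                  (λ { (_ , inj₁ t) → inj₁ (_ , t) ; (_ , inj₂ refl) → inj₂ (zero , refl) })
                  (∪-rankBounded {dom S} {Range (unrank α ∷ [])}
                    dom-bounded (range-rankBounded (unrank α ∷ [])))

            -- The union of all stages is coherent and has a pair over every element of `P` on
            -- either side, so it is the graph of a monotone bijection.
            condensation : ∃[ F ] IsOrderHomomorphism _≡_ _≡_ _<_ _<_ F ×
                                  Bijective _≡_ _≡_ F × F a < F b
            condensation =
              F ,
              record { cong = cong F ; mono = monotone (coh (graph _) (graph _)) } ,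
              ( injective (coh (graph _) (graph _))
              -- Stage `rank y` paired this element with `y`.
              , λ y → proj₂ (f (rank y)) , λ { refl →
                  functional (coh (graph _) (cograph y)) refl } ) ,
              -- The seed belongs to the union, so `F a` is `a` and `F b` is `c`.
              subst₂ _<_ (functional (coh (inj₁ (inj₁ refl)) (graph a)) refl)
                         (functional (coh (inj₁ (inj₂ refl)) (graph b)) refl) a<c
              where
              choice = transfiniteChoice
                -- `a` is the default value of both selectors.
                (×-selector (selector a ranking) (selector a ranking)) Good good-resp extend

              f : ∣κ∣ → P × P
              f = proj₁ choice

              coh : Coherent (Stages U λ {β} _ → f β)
              coh = stages-coherent f λ {α} _ → proj₂ choice α

              F : P → P
              F x = proj₁ (f (rank x))

              graph : ∀ x → (x , F x) ∈ Stages U λ {β} _ → f β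
              graph x = inj₂ (rank x , tt , inj₁ (cong (_, F x) (unrank-rank x)))

              cograph : ∀ y → (proj₂ (f (rank y)) , y) ∈ Stages U λ {β} _ → f β
              cograph y = inj₂ (rank y , tt , inj₂ (cong (proj₂ (f (rank y)) ,_) (unrank-rank y)))

          ¬reversible : ¬ Reversible
          ¬reversible reversible =
            -- Any point can start the construction. The seed fixes `p` and sends `b` to `c`, so `F`
            -- does not reflect `F p < F b`.
            let p = unrank (Injection.to infinite 0)
                _ , _ , b , _ , _ , b∥p = u2 (Range (p ∷ [])) (range-nonemptySmall (p ∷ []))
                _ , c , _ , _ , p<c , _ = u2 (Range (p ∷ [])) (range-nonemptySmall (p ∷ []))
                b≰p , p≰b = b∥p p (zero , refl)
                F , hom , bij , Fp<Fb = condensation (p≰b , b≰p) (p<c p c (zero , refl) refl)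
            in p≰b (inj₁ (IsOrderIsomorphism.cancel (reversible F hom bij) Fp<Fb))

  -- Homogeneous-universal posets and the case κ = ω.

  homogeneousUniversal⇒¬reversible : ∀ κ → Infinite κ → Regular κ → ∀ ℙ →
    Order.HomogeneousUniversal ℙ κ → ¬ Order.Reversible ℙ
  homogeneousUniversal⇒¬reversible κ infinite regular ℙ (size , homogeneous , universal) =
    BackAndForth.¬reversible
      (homogeneousUniversal⇒U1 homogeneous universal)
      (homogeneousUniversal⇒U2 homogeneous universal)
    where
    open CardinalProperties κ
    open PosetProperties infinite ℙ size
    open RegularPoset regular

  ω-infinite : Infinite ω
  ω-infinite = mk↣ {to = id} id

  -- A cofinal set contains a strictly increasing sequence, so Cantor-Bernstein makes it
  -- equinumerous with ℕ.
  ω-regular : Regular ω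
  ω-regular C cofinal (_ , ¬full) = ¬full (↔⇒⤖ (↔-sym (⤖⇒↔ (cantorBernstein C enumeration))))
    where
    above : ∀ n → ∃[ m ] m ∈ C × n ℕ.≤ m
    above n with cofinal n
    ... | m , m∈C , inj₁ n<m  = m , m∈C , ℕ.<⇒≤ n<m
    ... | m , m∈C , inj₂ refl = m , m∈C , ℕ.≤-refl

    enum : ℕ → ℕ
    enum zero    = proj₁ (above 0)
    -- The inner `suc` turns the weak bound given by `above` into strict increase.
    enum (suc n) = proj₁ (above (suc (enum n)))

    enum∈C : ∀ n → enum n ∈ C
    enum∈C zero    = proj₁ (proj₂ (above 0))
    enum∈C (suc n) = proj₁ (proj₂ (above (suc (enum n))))

    enum-mono : ∀ {m n} → m ℕ.<′ n → enum m ℕ.< enum n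
    enum-mono {m} ℕ.<′-base     = proj₂ (proj₂ (above (suc (enum m))))
    enum-mono     (ℕ.≤′-step {n} m<n) =
      ℕ.<-trans (enum-mono m<n) (proj₂ (proj₂ (above (suc (enum n)))))

    enum-injective : Injective _≡_ _≡_ enum
    enum-injective {m} {n} eq with ℕ.<-cmp m n
    ... | tri< m<n _ _ = ⊥-elim (ℕ.<-irrefl eq (enum-mono (ℕ.<⇒<′ m<n)))
    ... | tri≈ _ m≡n _ = m≡n
    ... | tri> _ _ n<m = ⊥-elim (ℕ.<-irrefl (sym eq) (enum-mono (ℕ.<⇒<′ n<m)))

    enumeration : ℕ ↣ ⟪ C ⟫
    enumeration = mk↣ {to = λ n → enum n ,ʳ [ enum∈C n ]} (enum-injective ∘ cong value)

theorem3p5 : ExcludedMiddle 0ℓ →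
    (∀ (κ : Cardinal) → Infinite κ →
    ∀ (ℙ : StrictPoset) → let open Order ℙ in
    ∣ P ∣≡ κ → U1 κ → U2 κ →
    (∀ L G → NonemptySmall κ L → NonemptySmall κ G → L <ˢ G →
    ∣ ⟪ Between L G ⟫ ∣≡ κ)
    × (∀ K → NonemptySmall κ K →
    (∣ ⟪ Below K ⟫ ∣≡ κ) × (∣ ⟪ Above K ⟫ ∣≡ κ) × (∣ ⟪ Incomparable K ⟫ ∣≡ κ))
    × (Regular κ → ¬ Reversible))
    × (∀ (κ : Cardinal) → Infinite κ → Regular κ →
    ∀ (ℙ : StrictPoset) → let open Order ℙ in
    HomogeneousUniversal κ → ¬ Reversible)
    × (∀ (ℙ : StrictPoset) → let open Order ℙ in
    IsCountableRandomPoset → ¬ Reversible)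
theorem3p5 em =
  (λ κ infinite ℙ size u1 u2 →
     let open CardinalProperties κ
         open PosetProperties infinite ℙ size
         open Dense u1 u2
     in (λ L G → between-full)
      , (λ K small → below-full small , above-full small , incomparable-full small)
      , (λ regular → RegularPoset.BackAndForth.¬reversible regular u1 u2))
  , homogeneousUniversal⇒¬reversible
  , homogeneousUniversal⇒¬reversible ω ω-infinite ω-regular
  where open Classical em
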